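{- Let $(T,\cdot,e)$ be a monoid and let $M$ be a $T$-graded monad on a locally presentable category $\mathbf{C}$ such that $M$ is accessible, i.e. each functor $M_t$ ($t\in T$) is accessible. Then the category $\mathbf{GCoAlg}(M)$ of graded $M$-coalgebras is complete; in particular it has a terminal object.
   Context: Accessible and locally presentable categories and accessible functors are meant in the standard sense (a functor between accessible categories is accessible if it preserves $\kappa$-directed colimits for some regular cardinal $\kappa$; a category is locally presentable if it is accessible and cocomplete). A monad $M$ graded by a monoid $(T,\cdot,e)$ on $\mathbf{C}$ consists of endofunctors $M_t$ ($t\in T$), natural transformations $\mu^{s,t}\colon M_sM_t\to M_{s\cdot t}$ and $\eta\colon\mathrm{Id}\to M_e$ such that $\mu^{r,s\cdot t}\circ M_r\mu^{s,t}=\mu^{r\cdot s,t}\circ\mu^{r,s}M_t$ and $\mu^{t,e}\circ M_t\eta=\mathrm{id}=\mu^{e,t}\circ\eta M_t$. A graded $M$-coalgebra is an object $X$ with morphisms $\gamma_t\colon X\to M_tX$ ($t\in T$) such that $\gamma_e=\eta_X$ and $\gamma_{s\cdot t}=\mu^{s,t}_X\circ M_s\gamma_t\circ\gamma_s$ for all $s,t\in T$. A homomorphism $h\colon(X,\gamma)\to(Y,\delta)$ is a morphism $h\colon X\to Y$ with $M_th\circ\gamma_t=\delta_t\circ h$ for all $t\in T$. These form the category $\mathbf{GCoAlg}(M)$. -}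

module Defs where

open import Level using (Level; _⊔_; suc)
open import Algebra.Structures using (IsMonoid)
open import Data.Nat.Base using (ℕ)
open import Data.Product using (Σ; ∃; _×_; _,_; proj₁; proj₂)
open import Data.Unit.Polymorphic using (⊤)
open import Function.Bundles using (Func; _⟨$⟩_; _↣_)
import Function.Construct.Composition as Composition
import Function.Construct.Identity as Identity
import Function.Relation.Binary.Setoid.Equality as FuncEq
open import Relation.Binary using (Rel; IsEquivalence; Setoid; Poset)
open import Relation.Binary.PropositionalEquality using (_≡_; refl)
open import Relation.Nullary using (¬_)

private
  variable
    o o′ ℓ : Level

------------------------------------------------------------------------
-- Categories
--
-- Hom-sets are setoids, and objects are never compared for equality.
-- The level ℓ of the hom-sets is the universe of small sets: every
-- category is locally small, and "small" means living in level ℓ.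

record Category (o ℓ : Level) : Set (suc (o ⊔ ℓ)) where
  infix  4 _≈_ _⇒_
  infixr 9 _∘_
  field
    Obj       : Set o
    _⇒_       : Obj → Obj → Set ℓ
    _≈_       : ∀ {A B} → Rel (A ⇒ B) ℓ
    id        : ∀ {A} → A ⇒ A
    _∘_       : ∀ {A B C} → B ⇒ C → A ⇒ B → A ⇒ C
    assoc     : ∀ {A B C D} {f : A ⇒ B} {g : B ⇒ C} {h : C ⇒ D} →
                (h ∘ g) ∘ f ≈ h ∘ (g ∘ f)
    identityˡ : ∀ {A B} {f : A ⇒ B} → id ∘ f ≈ f
    identityʳ : ∀ {A B} {f : A ⇒ B} → f ∘ id ≈ f
    equiv     : ∀ {A B} → IsEquivalence (_≈_ {A} {B})
    ∘-resp-≈  : ∀ {A B C} {f h : B ⇒ C} {g i : A ⇒ B} →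
                f ≈ h → g ≈ i → f ∘ g ≈ h ∘ i

  module Equiv {A B : Obj} = IsEquivalence (equiv {A} {B})

  hom-setoid : Obj → Obj → Setoid ℓ ℓ
  hom-setoid A B = record { isEquivalence = equiv {A} {B} }

  record _≅_ (A B : Obj) : Set ℓ where
    field
      to      : A ⇒ B
      from    : B ⇒ A
      to∘from : to ∘ from ≈ id
      from∘to : from ∘ to ≈ id

record Functor {o ℓ o′ ℓ′} (C : Category o ℓ) (D : Category o′ ℓ′) :
               Set (o ⊔ ℓ ⊔ o′ ⊔ ℓ′) where
  private
    module C = Category C
    module D = Category D
  field
    F₀           : C.Obj → D.Obj
    F₁           : ∀ {A B} → A C.⇒ B → F₀ A D.⇒ F₀ B
    identity     : ∀ {A} → F₁ (C.id {A}) D.≈ D.id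
    homomorphism : ∀ {X Y Z} {f : X C.⇒ Y} {g : Y C.⇒ Z} →
                   F₁ (g C.∘ f) D.≈ F₁ g D.∘ F₁ f
    F-resp-≈     : ∀ {A B} {f g : A C.⇒ B} → f C.≈ g → F₁ f D.≈ F₁ g

idF : {C : Category o ℓ} → Functor C C
idF {C = C} = record
  { F₀           = λ A → A
  ; F₁           = λ f → f
  ; identity     = Equiv.refl
  ; homomorphism = Equiv.refl
  ; F-resp-≈     = λ f≈g → f≈g
  } where open Category C

infixr 9 _∘F_

_∘F_ : ∀ {o₁ ℓ₁ o₂ ℓ₂ o₃ ℓ₃} {C : Category o₁ ℓ₁} {D : Category o₂ ℓ₂}
       {E : Category o₃ ℓ₃} → Functor D E → Functor C D → Functor C E
_∘F_ {E = E} G F = record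
  { F₀           = λ A → G.F₀ (F.F₀ A)
  ; F₁           = λ f → G.F₁ (F.F₁ f)
  ; identity     = Equiv.trans (G.F-resp-≈ F.identity) G.identity
  ; homomorphism = Equiv.trans (G.F-resp-≈ F.homomorphism) G.homomorphism
  ; F-resp-≈     = λ f≈g → G.F-resp-≈ (F.F-resp-≈ f≈g)
  }
  where
  open Category E
  module F = Functor F
  module G = Functor G

record NaturalTransformation {o ℓ o′ ℓ′} {C : Category o ℓ} {D : Category o′ ℓ′}
                             (F G : Functor C D) : Set (o ⊔ ℓ ⊔ o′ ⊔ ℓ′) where
  private
    module C = Category C
    module D = Category D
    module F = Functor F
    module G = Functor G
  field
    component : ∀ X → F.F₀ X D.⇒ G.F₀ X
    commute   : ∀ {X Y} (f : X C.⇒ Y) →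
                component Y D.∘ F.F₁ f D.≈ G.F₁ f D.∘ component X

Setoids : (ℓ : Level) → Category (suc ℓ) ℓ
Setoids ℓ = record
  { Obj       = Setoid ℓ ℓ
  ; _⇒_       = Func
  ; _≈_       = λ {A} {B} → FuncEq._≈_ A B
  ; id        = λ {A} → Identity.function A
  ; _∘_       = λ g f → Composition.function f g
  ; assoc     = λ {_} {_} {_} {D} → λ _ → Setoid.refl D
  ; identityˡ = λ {_} {B} → λ _ → Setoid.refl B
  ; identityʳ = λ {_} {B} → λ _ → Setoid.refl B
  ; equiv     = λ {A} {B} → FuncEq.isEquivalence A B
  ; ∘-resp-≈  = λ {_} {_} {C} {f} f≈h g≈i →
                  λ x → Setoid.trans C (Func.cong f (g≈i x)) (f≈h _)
  }

Hom[_,-] : {C : Category o ℓ} → Category.Obj C → Functor C (Setoids ℓ)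
Hom[_,-] {C = C} A = record
  { F₀           = hom-setoid A
  ; F₁           = λ f → record
      { to = λ g → f ∘ g ; cong = λ g≈h → ∘-resp-≈ Equiv.refl g≈h }
  ; identity     = λ _ → identityˡ
  ; homomorphism = λ _ → assoc
  ; F-resp-≈     = λ f≈g _ → ∘-resp-≈ f≈g Equiv.refl
  } where open Category C

------------------------------------------------------------------------
-- Limits and colimits

module _ {o ℓ o′ ℓ′} {J : Category o′ ℓ′} {C : Category o ℓ} (F : Functor J C) where
  private
    module J = Category J
    open Category C
    open Functor F

  record Cocone (N : Obj) : Set (ℓ ⊔ o′ ⊔ ℓ′) where
    field
      ψ       : ∀ j → F₀ j ⇒ N
      commute : ∀ {i j} (f : i J.⇒ j) → ψ j ∘ F₁ f ≈ ψ i

  record IsColimit {N : Obj} (K : Cocone N) : Set (o ⊔ ℓ ⊔ o′ ⊔ ℓ′) where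
    private module K = Cocone K
    field
      mediate  : ∀ {X} → Cocone X → N ⇒ X
      factors  : ∀ {X} (L : Cocone X) j → mediate L ∘ K.ψ j ≈ Cocone.ψ L j
      unique   : ∀ {X} (L : Cocone X) (u : N ⇒ X) →
                 (∀ j → u ∘ K.ψ j ≈ Cocone.ψ L j) → u ≈ mediate L

  Colimit : Set (o ⊔ ℓ ⊔ o′ ⊔ ℓ′)
  Colimit = Σ Obj λ N → Σ (Cocone N) IsColimit

  record Cone (N : Obj) : Set (ℓ ⊔ o′ ⊔ ℓ′) where
    field
      π       : ∀ j → N ⇒ F₀ j
      commute : ∀ {i j} (f : i J.⇒ j) → F₁ f ∘ π i ≈ π j

  record IsLimit {N : Obj} (K : Cone N) : Set (o ⊔ ℓ ⊔ o′ ⊔ ℓ′) where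
    private module K = Cone K
    field
      mediate  : ∀ {X} → Cone X → X ⇒ N
      factors  : ∀ {X} (L : Cone X) j → K.π j ∘ mediate L ≈ Cone.π L j
      unique   : ∀ {X} (L : Cone X) (u : X ⇒ N) →
                 (∀ j → K.π j ∘ u ≈ Cone.π L j) → u ≈ mediate L

  Limit : Set (o ⊔ ℓ ⊔ o′ ⊔ ℓ′)
  Limit = Σ Obj λ N → Σ (Cone N) IsLimit

mapCocone : ∀ {o₁ ℓ₁ o₂ ℓ₂ o₃ ℓ₃} {J : Category o₁ ℓ₁} {C : Category o₂ ℓ₂}
            {D : Category o₃ ℓ₃} (G : Functor C D) {F : Functor J C}
            {N : Category.Obj C} → Cocone F N → Cocone (G ∘F F) (Functor.F₀ G N)
mapCocone {D = D} G K = record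
  { ψ       = λ j → F₁ (ψ j)
  ; commute = λ f → Equiv.trans (Equiv.sym homomorphism) (F-resp-≈ (commute f))
  }
  where
  open Category D
  open Functor G
  open Cocone K

Cocomplete : Category o ℓ → Set (o ⊔ suc ℓ)
Cocomplete {ℓ = ℓ} C = (J : Category ℓ ℓ) (F : Functor J C) → Colimit F

Complete : Category o ℓ → Set (o ⊔ suc ℓ)
Complete {ℓ = ℓ} C = (J : Category ℓ ℓ) (F : Functor J C) → Limit F

record Terminal (C : Category o ℓ) : Set (o ⊔ ℓ) where
  open Category C
  field
    one      : Obj
    !        : ∀ {X} → X ⇒ one
    !-unique : ∀ {X} (f : X ⇒ one) → f ≈ !

------------------------------------------------------------------------
-- Regular cardinals

infix 4 _≺_

-- Strictly smaller cardinality.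
_≺_ : ∀ {a b} → Set a → Set b → Set (a ⊔ b)
A ≺ B = (A ↣ B) × ¬ (B ↣ A)

-- A cardinal is given by a small set of that cardinality.  It is regular
-- if it is infinite and is not reached by a sum of fewer smaller cardinals.
record RegularCardinal (ℓ : Level) : Set (suc ℓ) where
  field
    ∣κ∣      : Set ℓ
    infinite : ℕ ↣ ∣κ∣
    regular  : (I : Set ℓ) (A : I → Set ℓ) →
               I ≺ ∣κ∣ → (∀ i → A i ≺ ∣κ∣) → Σ I A ≺ ∣κ∣

open RegularCardinal public using (∣κ∣)

------------------------------------------------------------------------
-- Accessible and locally presentable categories

-- Subsets of cardinality less than κ are given as families indexed by
-- sets of cardinality less than κ.
IsDirected : RegularCardinal ℓ → Poset ℓ ℓ ℓ → Set (suc ℓ)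
IsDirected {ℓ} κ P =
  (I : Set ℓ) → I ≺ ∣κ∣ κ → (x : I → Carrier) → ∃ λ u → ∀ i → x i ≤ u
  where open Poset P

posetCategory : Poset ℓ ℓ ℓ → Category ℓ ℓ
posetCategory P = record
  { Obj       = Carrier
  ; _⇒_       = _≤_
  ; _≈_       = λ _ _ → ⊤
  ; id        = P.refl
  ; _∘_       = λ y≤z x≤y → P.trans x≤y y≤z
  ; assoc     = _
  ; identityˡ = _
  ; identityʳ = _
  ; equiv     = _
  ; ∘-resp-≈  = _
  }
  where
  module P = Poset P
  open P using (Carrier; _≤_)

PreservesDirectedColimits : {C : Category o ℓ} {D : Category o′ ℓ} →
                            RegularCardinal ℓ → Functor C D → Set (o ⊔ o′ ⊔ suc ℓ)
PreservesDirectedColimits {ℓ = ℓ} {C = C} κ G =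
  (P : Poset ℓ ℓ ℓ) → IsDirected κ P →
  (F : Functor (posetCategory P) C) {N : Category.Obj C} (K : Cocone F N) →
  IsColimit F K → IsColimit (G ∘F F) (mapCocone G K)

IsPresentable : (C : Category o ℓ) → RegularCardinal ℓ → Category.Obj C → Set (o ⊔ suc ℓ)
IsPresentable C κ A = PreservesDirectedColimits κ (Hom[_,-] {C = C} A)

record IsAccessibleAt (C : Category o ℓ) (κ : RegularCardinal ℓ) :
                      Set (o ⊔ suc ℓ) where
  open Category C
  field
    directedColimits : (P : Poset ℓ ℓ ℓ) → IsDirected κ P →
                       (F : Functor (posetCategory P) C) → Colimit F

    -- A small set of κ-presentable objects.
    G           : Set ℓ
    generator   : G → Obj
    presentable : ∀ g → IsPresentable C κ (generator g)

    -- Every object is a κ-directed colimit of objects from that set.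
    generates   : ∀ X →
      Σ (Poset ℓ ℓ ℓ) λ P →
      Σ (Functor (posetCategory P) C) λ F →
      Σ (Cocone F X) λ K →
        IsDirected κ P ×
        (∀ p → ∃ λ g → Functor.F₀ F p ≅ generator g) ×
        IsColimit F K

IsAccessible : Category o ℓ → Set (o ⊔ suc ℓ)
IsAccessible {ℓ = ℓ} C = Σ (RegularCardinal ℓ) (IsAccessibleAt C)

IsLocallyPresentable : Category o ℓ → Set (o ⊔ suc ℓ)
IsLocallyPresentable C = IsAccessible C × Cocomplete C

-- To be used only for functors between accessible categories.
IsAccessibleFunctor : {C : Category o ℓ} {D : Category o′ ℓ} →
                      Functor C D → Set (o ⊔ o′ ⊔ suc ℓ)
IsAccessibleFunctor {ℓ = ℓ} F =
  Σ (RegularCardinal ℓ) λ κ → PreservesDirectedColimits κ F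

------------------------------------------------------------------------
-- Graded monads and graded coalgebras

-- The identity morphism of M s X, regraded along an equality of grades.
-- It is needed because the two sides of each graded monad law have grades
-- that agree only by a law of the monoid of grades.
regrade : {T : Set ℓ} {C : Category o ℓ} (M : T → Functor C C) {s t : T} → s ≡ t →
          ∀ X → Category._⇒_ C (Functor.F₀ (M s) X) (Functor.F₀ (M t) X)
regrade {C = C} M refl X = Category.id C

module _ {T : Set ℓ} {_·_ : T → T → T} {e : T} where

  record GradedMonad (T-monoid : IsMonoid _≡_ _·_ e) (C : Category o ℓ) :
                     Set (o ⊔ ℓ) where
    open Category C
    private module T = IsMonoid T-monoid
    field
      M : T → Functor C C
      μ : ∀ s t → NaturalTransformation (M s ∘F M t) (M (s · t))
      η : NaturalTransformation idF (M e)

    M₀ : T → Obj → Obj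
    M₀ t = Functor.F₀ (M t)

    M₁ : ∀ t {X Y} → X ⇒ Y → M₀ t X ⇒ M₀ t Y
    M₁ t = Functor.F₁ (M t)

    μ₀ : ∀ s t X → M₀ s (M₀ t X) ⇒ M₀ (s · t) X
    μ₀ s t = NaturalTransformation.component (μ s t)

    η₀ : ∀ X → X ⇒ M₀ e X
    η₀ = NaturalTransformation.component η

    field
      μ-assoc : ∀ r s t X →
        regrade M (T.assoc r s t) X ∘ (μ₀ (r · s) t X ∘ μ₀ r s (M₀ t X))
          ≈ μ₀ r (s · t) X ∘ M₁ r (μ₀ s t X)
      μ-identityʳ : ∀ t X →
        regrade M (T.identityʳ t) X ∘ (μ₀ t e X ∘ M₁ t (η₀ X)) ≈ id
      μ-identityˡ : ∀ t X →
        regrade M (T.identityˡ t) X ∘ (μ₀ e t X ∘ η₀ (M₀ t X)) ≈ id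

  module _ {T-monoid : IsMonoid _≡_ _·_ e} {C : Category o ℓ}
           (𝑀 : GradedMonad T-monoid C) where
    open Category C
    open GradedMonad 𝑀

    record GradedCoalgebra : Set (o ⊔ ℓ) where
      field
        X      : Obj
        γ      : ∀ t → X ⇒ M₀ t X
        γ-unit : γ e ≈ η₀ X
        γ-mult : ∀ s t → γ (s · t) ≈ μ₀ s t X ∘ (M₁ s (γ t) ∘ γ s)

    record CoalgebraHom (A B : GradedCoalgebra) : Set ℓ where
      private
        module A = GradedCoalgebra A
        module B = GradedCoalgebra B
      field
        h       : A.X ⇒ B.X
        commute : ∀ t → M₁ t h ∘ A.γ t ≈ B.γ t ∘ h

    open CoalgebraHom

    GCoAlg : Category (o ⊔ ℓ) ℓ
    GCoAlg = record
      { Obj       = GradedCoalgebra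
      ; _⇒_       = CoalgebraHom
      ; _≈_       = λ f g → h f ≈ h g
      ; id        = record
          { h       = id
          ; commute = λ t → Equiv.trans
              (∘-resp-≈ (Functor.identity (M t)) Equiv.refl)
              (Equiv.trans identityˡ (Equiv.sym identityʳ))
          }
      ; _∘_       = λ g f → record
          { h       = h g ∘ h f
          ; commute = λ t →
              Equiv.trans (∘-resp-≈ (Functor.homomorphism (M t)) Equiv.refl)
              (Equiv.trans assoc
              (Equiv.trans (∘-resp-≈ Equiv.refl (commute f t))
              (Equiv.trans (Equiv.sym assoc)
              (Equiv.trans (∘-resp-≈ (commute g t) Equiv.refl)
              assoc))))
          }
      ; assoc     = assoc
      ; identityˡ = identityˡ
      ; identityʳ = identityʳ
      ; equiv     = record
          { refl = Equiv.refl ; sym = Equiv.sym ; trans = Equiv.trans }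
      ; ∘-resp-≈  = ∘-resp-≈
      }

{-# OPTIONS --safe #-}
module Submission where

-- A cocomplete category in which every object is a colimit of objects from a
-- small set is complete: the cones over a fixed diagram form a category of
-- the same kind, the colimit of all its small objects is weakly terminal,
-- and Freyd's argument makes it terminal.
--
-- GCoAlg(M) inherits colimits from C.  To write a coalgebra X as a colimit of
-- small coalgebras, let X = colim F over a poset P with values in the
-- generators, and fix an index set A so large that posets in which A-indexed
-- families are bounded are directed for all cardinals involved; this makes
-- successor cardinals superfluous.  For x : A → P let ∣ x ∣ be the colimit of
-- F over the image of x.  These images form such a poset, with colimit X, so
-- each F p → X → M t X factors through some M t ∣ x ∣, and two such
-- factorizations agree in a larger one.  Hence every family closed under
-- finitary choices of such bounds carries a coalgebra structure making
-- ∣ x ∣ → X a homomorphism, and X is the colimit of these ∣ x ∣.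

open import Defs
open import Level using (Level; Lift; lift; lower; _⊔_) renaming (suc to lsuc)
open import Algebra.Structures using (IsMonoid)
open import Axiom.ExcludedMiddle using (ExcludedMiddle)
open import Axiom.Extensionality.Propositional using (Extensionality)
open import Data.Bool.Base using (Bool; true; false) renaming (T to IsTrue)
open import Data.Empty using (⊥; ⊥-elim)
open import Data.Maybe.Base using (Maybe; just; nothing)
open import Data.Nat.Base using (zero)
open import Data.Product using (Σ; ∃; _×_; _,_; proj₁; proj₂)
open import Data.Sum.Base using (_⊎_; inj₁; inj₂)
open import Data.Unit.Polymorphic using (⊤; tt)
open import Function.Base using (_$_)
open import Function.Bundles using (Func; Injection; _↣_; mk↣)
import Function.Construct.Composition as Composition
open import Relation.Binary using (Poset; Setoid)
open import Relation.Binary.PropositionalEquality using (_≡_; refl)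
import Relation.Binary.Reasoning.Setoid as SetoidReasoning
open import Relation.Nullary using (Dec; yes; no)
open import Relation.Nullary.Decidable using (⌊_⌋; toWitness; fromWitness)

private
  variable
    o o′ ℓ : Level

-- Equational reasoning, small full subcategories and relabelled diagrams.

module Reasoning (C : Category o ℓ) where
  open Category C
  open Equiv public using () renaming (refl to ≈-refl; sym to ≈-sym; trans to ≈-trans)

  module HomReasoning {A B : Obj} = SetoidReasoning (hom-setoid A B)
  open HomReasoning public

  infixr 4 _⟩∘_ _∘⟨_

  _⟩∘_ : ∀ {X Y Z} {f g : Y ⇒ Z} → f ≈ g → (h : X ⇒ Y) → f ∘ h ≈ g ∘ h
  p ⟩∘ h = ∘-resp-≈ p ≈-refl

  _∘⟨_ : ∀ {X Y Z} {f g : X ⇒ Y} (h : Y ⇒ Z) → f ≈ g → h ∘ f ≈ h ∘ g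
  h ∘⟨ p = ∘-resp-≈ ≈-refl p

  pullˡ : ∀ {W X Y Z} {f : Y ⇒ Z} {g : X ⇒ Y} {h : W ⇒ X} {k : X ⇒ Z} →
          f ∘ g ≈ k → f ∘ (g ∘ h) ≈ k ∘ h
  pullˡ p = ≈-trans (≈-sym assoc) (p ⟩∘ _)

  pullʳ : ∀ {W X Y Z} {f : Y ⇒ Z} {g : X ⇒ Y} {h : W ⇒ X} {k : W ⇒ Y} →
          g ∘ h ≈ k → (f ∘ g) ∘ h ≈ f ∘ k
  pullʳ p = ≈-trans assoc (_ ∘⟨ p)

Full : (C : Category o ℓ) {I : Set ℓ} → (I → Category.Obj C) → Category ℓ ℓ
Full C {I} obj = record
  { Obj       = I
  ; _⇒_       = λ i j → obj i ⇒ obj j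
  ; _≈_       = _≈_
  ; id        = id
  ; _∘_       = _∘_
  ; assoc     = assoc
  ; identityˡ = identityˡ
  ; identityʳ = identityʳ
  ; equiv     = equiv
  ; ∘-resp-≈  = ∘-resp-≈
  } where open Category C

module _ (C : Category o ℓ) {I : Set ℓ} (obj : I → Category.Obj C) where
  open Category C

  embed : Functor (Full C obj) C
  embed = record
    { F₀           = obj
    ; F₁           = λ f → f
    ; identity     = Equiv.refl
    ; homomorphism = Equiv.refl
    ; F-resp-≈     = λ p → p
    }

module _ {J : Category o′ ℓ} {C : Category o ℓ} {F : Functor J C}
         {N : Category.Obj C} {K : Cocone F N} (isK : IsColimit F K) where
  open Category C
  open Reasoning C
  open Cocone K
  open IsColimit isK

  postcompose : ∀ {Y} → N ⇒ Y → Cocone F Y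
  postcompose v = record
    { ψ = λ j → v ∘ ψ j ; commute = λ f → pullʳ (commute f) }

  jointly-epic : ∀ {Y} {u v : N ⇒ Y} → (∀ j → u ∘ ψ j ≈ v ∘ ψ j) → u ≈ v
  jointly-epic {v = v} p =
    ≈-trans (unique (postcompose v) _ p)
            (≈-sym (unique (postcompose v) v (λ _ → ≈-refl)))

-- Accessibility gives diagram objects only up to isomorphism with generators, whereas the small
-- coalgebras need diagrams coded by labels. Conjugating the arrows by the isomorphisms supplies
-- one.
module Relabel
  {C : Category o ℓ} {J : Category ℓ ℓ} {F : Functor J C} {S : Set ℓ}
  (obj : S → Category.Obj C) (label : Category.Obj J → S)
  (iso : ∀ j → Category._≅_ C (Functor.F₀ F j) (obj (label j)))
  {X : Category.Obj C} {K : Cocone F X} (isK : IsColimit F K)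
  where
  open Category C
  open Reasoning C
  open Functor F
  open Cocone K
  private module I j = _≅_ (iso j)

  cancel : ∀ {Y} j (f : Y ⇒ F₀ j) → I.from j ∘ (I.to j ∘ f) ≈ f
  cancel j f = ≈-trans (pullˡ (I.from∘to j)) identityˡ

  relabelled : Functor J (Full C obj)
  relabelled = record
    { F₀           = label
    ; F₁           = λ {i} {j} f → I.to j ∘ (F₁ f ∘ I.from i)
    ; identity     = λ {i} →
        ≈-trans (_ ∘⟨ ≈-trans (identity ⟩∘ _) identityˡ) (I.to∘from i)
    ; homomorphism = λ {i} {j} {k} {f} {g} → begin
        I.to k ∘ (F₁ _ ∘ I.from i)
          ≈⟨ _ ∘⟨ ≈-trans (homomorphism ⟩∘ _) assoc ⟩
        I.to k ∘ (F₁ g ∘ (F₁ f ∘ I.from i))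
          ≈⟨ _ ∘⟨ _ ∘⟨ cancel j _ ⟨
        I.to k ∘ (F₁ g ∘ (I.from j ∘ (I.to j ∘ (F₁ f ∘ I.from i))))
          ≈⟨ ≈-trans assoc (_ ∘⟨ assoc) ⟨
        (I.to k ∘ (F₁ g ∘ I.from j)) ∘ (I.to j ∘ (F₁ f ∘ I.from i)) ∎
    ; F-resp-≈     = λ p → _ ∘⟨ (F-resp-≈ p ⟩∘ _)
    }

  cocone : Cocone (embed C obj ∘F relabelled) X
  cocone = record
    { ψ       = λ j → ψ j ∘ I.from j
    ; commute = λ {i} {j} f → begin
        (ψ j ∘ I.from j) ∘ (I.to j ∘ (F₁ f ∘ I.from i)) ≈⟨ pullʳ (cancel j _) ⟩
        ψ j ∘ (F₁ f ∘ I.from i)                         ≈⟨ pullˡ (commute f) ⟩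
        ψ i ∘ I.from i                                  ∎
    }

  original : ∀ {Y} → Cocone (embed C obj ∘F relabelled) Y → Cocone F Y
  original L = record
    { ψ       = λ j → Cocone.ψ L j ∘ I.to j
    ; commute = λ {i} {j} f → begin
        (Cocone.ψ L j ∘ I.to j) ∘ F₁ f
          ≈⟨ _ ∘⟨ ≈-trans (_ ∘⟨ I.from∘to i) identityʳ ⟨
        (Cocone.ψ L j ∘ I.to j) ∘ (F₁ f ∘ (I.from i ∘ I.to i))
          ≈⟨ ≈-trans assoc (_ ∘⟨ ≈-trans (_ ∘⟨ ≈-sym assoc) (≈-sym assoc)) ⟩
        Cocone.ψ L j ∘ ((I.to j ∘ (F₁ f ∘ I.from i)) ∘ I.to i)
          ≈⟨ pullˡ (Cocone.commute L f) ⟩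
        Cocone.ψ L i ∘ I.to i ∎
    }

  isColimit : IsColimit (embed C obj ∘F relabelled) cocone
  isColimit = record
    { mediate = λ L → mediate (original L)
    ; factors = λ L j → ≈-trans (pullˡ (factors (original L) j))
        (≈-trans (pullʳ (I.to∘from j)) identityʳ)
    ; unique  = λ L u h → unique (original L) u λ j → begin
        u ∘ ψ j                          ≈⟨ _ ∘⟨ ≈-trans (_ ∘⟨ I.from∘to j) identityʳ ⟨
        u ∘ (ψ j ∘ (I.from j ∘ I.to j))  ≈⟨ _ ∘⟨ assoc ⟨
        u ∘ ((ψ j ∘ I.from j) ∘ I.to j)  ≈⟨ pullˡ (h j) ⟩
        Cocone.ψ L j ∘ I.to j            ∎
    }
    where open IsColimit isK

-- Completeness from colimit generation

-- Landing in `Full C obj` puts every diagram inside one small category, whose colimit cocone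
-- therefore restricts to each diagram.
ColimitGenerated : Category o ℓ → Set (o ⊔ lsuc ℓ)
ColimitGenerated {ℓ = ℓ} C =
  Σ (Set ℓ) λ S → Σ (S → Category.Obj C) λ obj → ∀ X →
  Σ (Category ℓ ℓ) λ I → Σ (Functor I (Full C obj)) λ H →
  Σ (Cocone (embed C obj ∘F H) X) (IsColimit _)

-- Freyd's argument.  Let q : W ⇒ N be the joint coequalizer of all
-- endomorphisms of W.  If c : N ⇒ Z identifies f and g, then composing c
-- with a map Z ⇒ W and q gives an endomorphism of N that fixes q, hence the
-- identity; so c is monic and f ≈ g.
module _ {C : Category o ℓ} (cocomplete : Cocomplete C) where
  open Category C
  open Reasoning C

  weaklyTerminal⇒terminal : (W : Obj) → (∀ X → X ⇒ W) → Terminal C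
  weaklyTerminal⇒terminal W weak = record
    { one = N ; ! = q ∘ weak _ ; !-unique = λ f → equal f _ }
    where
    endo : Functor (Full C {I = ⊤} (λ _ → W)) C
    endo = embed C (λ _ → W)
    N    = proj₁ (cocomplete _ endo)
    open Cocone (proj₁ (proj₂ (cocomplete _ endo)))
    q : W ⇒ N
    q = ψ tt

    equal : ∀ {X} (f g : X ⇒ N) → f ≈ g
    equal {X} f g = begin
      f             ≈⟨ identityˡ ⟨
      id ∘ f        ≈⟨ split ⟩∘ f ⟨
      (r ∘ c) ∘ f   ≈⟨ pullʳ (≈-trans (commutes f) (≈-sym (commutes g))) ⟩
      r ∘ (c ∘ g)   ≈⟨ pullˡ split ⟩
      id ∘ g        ≈⟨ identityˡ ⟩
      g             ∎
      where
      -- The full subcategory on `X` and `N` replaces the parallel pair: `f` and `g` are among its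
      -- arrows, so `c` sends both to the leg at `X`.
      two : Lift ℓ Bool → Obj
      two (lift false) = X
      two (lift true)  = N
      Z = cocomplete _ (embed C two)
      module Z = Cocone (proj₁ (proj₂ Z))
      c : N ⇒ proj₁ Z
      c = Z.ψ (lift true)
      commutes : (k : X ⇒ N) → c ∘ k ≈ Z.ψ (lift false)
      commutes = Z.commute {lift false} {lift true}
      r : proj₁ Z ⇒ N
      r = q ∘ weak _
      split : r ∘ c ≈ id
      split = jointly-epic (proj₂ (proj₂ (cocomplete _ endo))) λ _ → begin
        (r ∘ c) ∘ q                ≈⟨ ≈-trans assoc assoc ⟩
        q ∘ (weak _ ∘ (c ∘ q))     ≈⟨ commute _ ⟩
        q                          ≈⟨ identityˡ ⟨
        id ∘ q                     ∎

  colimitGenerated⇒terminal : ColimitGenerated C → Terminal C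
  colimitGenerated⇒terminal (S , obj , generate) = weaklyTerminal⇒terminal W weak
    where
    full = cocomplete _ (embed C obj)
    W    = proj₁ full
    open Cocone (proj₁ (proj₂ full))
    weak : ∀ X → X ⇒ W
    weak X with I , H , K , isK ← generate X = IsColimit.mediate isK record
      { ψ = λ i → ψ (Functor.F₀ H i) ; commute = λ f → commute (Functor.F₁ H f) }

module _ {C : Category o ℓ} {J : Category ℓ ℓ} (F : Functor J C) where
  private module J = Category J
  open Category C
  open Reasoning C
  open Functor F

  record ConeHom (A B : Σ Obj (Cone F)) : Set ℓ where
    private
      module A = Cone (proj₂ A)
      module B = Cone (proj₂ B)
    field
      h       : proj₁ A ⇒ proj₁ B
      commute : ∀ j → B.π j ∘ h ≈ A.π j

  open ConeHom

  Cones : Category (o ⊔ ℓ) ℓ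
  Cones = record
    { Obj       = Σ Obj (Cone F)
    ; _⇒_       = ConeHom
    ; _≈_       = λ f g → h f ≈ h g
    ; id        = record { h = id ; commute = λ _ → identityʳ }
    ; _∘_       = λ g f → record
        { h = h g ∘ h f ; commute = λ j → ≈-trans (pullˡ (commute g j)) (commute f j) }
    ; assoc     = assoc
    ; identityˡ = identityˡ
    ; identityʳ = identityʳ
    ; equiv     = record
        { refl = Equiv.refl ; sym = Equiv.sym ; trans = Equiv.trans }
    ; ∘-resp-≈  = ∘-resp-≈
    }

  apex : Functor Cones C
  apex = record
    { F₀           = proj₁
    ; F₁           = h
    ; identity     = Equiv.refl
    ; homomorphism = Equiv.refl
    ; F-resp-≈     = λ p → p
    }

  -- The mediating map respects the cone legs because this can be tested on the jointly epic colimit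
  -- legs, which are cone morphisms.
  apex-reflectsColimits : {I : Category ℓ ℓ} (H : Functor I Cones) {N : Σ Obj (Cone F)}
                          (K : Cocone H N) → IsColimit (apex ∘F H) (mapCocone apex K) →
                          IsColimit H K
  apex-reflectsColimits H {N} K isK = record
    { mediate = λ L → record
        { h       = mediate (mapCocone apex L)
        ; commute = λ j → jointly-epic isK λ i → begin
            (π L j ∘ mediate (mapCocone apex L)) ∘ h (Cocone.ψ K i)
              ≈⟨ pullʳ (factors (mapCocone apex L) i) ⟩
            π L j ∘ h (Cocone.ψ L i)
              ≈⟨ commute (Cocone.ψ L i) j ⟩
            Cone.π (proj₂ (Functor.F₀ H i)) j
              ≈⟨ commute (Cocone.ψ K i) j ⟨
            Cone.π (proj₂ N) j ∘ h (Cocone.ψ K i) ∎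
        }
    ; factors = λ L → factors (mapCocone apex L)
    ; unique  = λ L u → unique (mapCocone apex L) (h u)
    }
    where
    open IsColimit isK
    π : ∀ {X} → Cocone H X → ∀ j → proj₁ X ⇒ F₀ j
    π {X} _ = Cone.π (proj₂ X)

  Cones-cocomplete : Cocomplete C → Cocomplete Cones
  Cones-cocomplete cocomplete I H
    with N , K , isK ← cocomplete I (apex ∘F H) =
    (N , cone) , cocone , apex-reflectsColimits H cocone record
      { mediate = λ L → mediate (copy L)
      ; factors = λ L → factors (copy L)
      ; unique  = λ L → unique (copy L)
      }
    where
    open IsColimit isK
    copy : ∀ {X} → Cocone (apex ∘F H) X → Cocone (apex ∘F H) X
    copy L = record { ψ = Cocone.ψ L ; commute = Cocone.commute L }
    leg : ∀ j → Cocone (apex ∘F H) (F₀ j)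
    leg j = record
      { ψ       = λ i → Cone.π (proj₂ (Functor.F₀ H i)) j
      ; commute = λ f → commute (Functor.F₁ H f) j
      }
    cone : Cone F N
    cone = record
      { π       = λ j → mediate (leg j)
      ; commute = λ {i} {j} f → unique (leg j) _ λ k →
          ≈-trans (pullʳ (factors (leg i) k))
                  (Cone.commute (proj₂ (Functor.F₀ H k)) f)
      }
    cocone : Cocone H (N , cone)
    cocone = record
      { ψ       = λ i → record { h = Cocone.ψ K i ; commute = λ j → factors (leg j) i }
      ; commute = Cocone.commute K
      }

  -- Since `J` and the hom-sets are small, each `obj s` carries only a small set of cones.
  -- Restricting the given cone along the colimit legs lifts the diagram to cones.
  Cones-colimitGenerated : ColimitGenerated C → ColimitGenerated Cones
  Cones-colimitGenerated (S , obj , generate) =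
    Σ S (λ s → Cone F (obj s)) , (λ (s , c) → obj s , c) , λ (X , c) →
    let I , H , K , isK = generate X
        open Functor H using () renaming (F₀ to H₀; F₁ to H₁)
        open Cocone K using (ψ) renaming (commute to ψ-commute)
        open Cone c using (π) renaming (commute to π-commute)
        H′ : Functor I (Full Cones {I = Σ S (λ s → Cone F (obj s))} (λ (s , c) → obj s , c))
        H′ = record
          { F₀           = λ i → H₀ i , record
              { π = λ j → π j ∘ ψ i ; commute = λ f → pullˡ (π-commute f) }
          ; F₁           = λ f → record
              { h = H₁ f ; commute = λ j → pullʳ (ψ-commute f) }
          ; identity     = Functor.identity H
          ; homomorphism = Functor.homomorphism H
          ; F-resp-≈     = Functor.F-resp-≈ H
          }
        K′ : Cocone (embed Cones _ ∘F H′) (X , c)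
        K′ = record
          { ψ       = λ i → record { h = ψ i ; commute = λ j → ≈-refl }
          ; commute = ψ-commute
          }
        copy : ∀ {Y} → Cocone (apex ∘F embed Cones _ ∘F H′) Y → Cocone (embed C obj ∘F H) Y
        copy L = record { ψ = Cocone.ψ L ; commute = Cocone.commute L }
    in I , H′ , K′ , apex-reflectsColimits _ K′ record
      { mediate = λ L → IsColimit.mediate isK (copy L)
      ; factors = λ L → IsColimit.factors isK (copy L)
      ; unique  = λ L → IsColimit.unique isK (copy L)
      }

  terminalCone⇒limit : Terminal Cones → Limit F
  terminalCone⇒limit t = proj₁ one , proj₂ one , record
    { mediate = λ L → h (! {_ , L})
    ; factors = λ L → commute (! {_ , L})
    ; unique  = λ L u p → !-unique {_ , L} record { h = u ; commute = p }
    }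
    where open Terminal t

cocomplete∧colimitGenerated⇒complete :
  {C : Category o ℓ} → Cocomplete C → ColimitGenerated C → Complete C
cocomplete∧colimitGenerated⇒complete cocomplete generated J F =
  terminalCone⇒limit F $
  colimitGenerated⇒terminal (Cones-cocomplete F cocomplete) (Cones-colimitGenerated F generated)

-- Graded coalgebras

module _ {T : Set ℓ} {_·_ : T → T → T} {e : T} {T-monoid : IsMonoid _≡_ _·_ e}
         {C : Category o ℓ} (𝑀 : GradedMonad T-monoid C) where
  open Category C
  open Reasoning C
  open GradedMonad 𝑀

  M-∘ : ∀ t {X Y Z} {f : Y ⇒ Z} {g : X ⇒ Y} → M₁ t (f ∘ g) ≈ M₁ t f ∘ M₁ t g
  M-∘ t = Functor.homomorphism (M t)

  M-≈ : ∀ t {X Y} {f g : X ⇒ Y} → f ≈ g → M₁ t f ≈ M₁ t g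
  M-≈ t = Functor.F-resp-≈ (M t)

  M-merge : ∀ t {X Y Z} {f : Y ⇒ Z} {g : X ⇒ Y} {h : X ⇒ Z} →
            f ∘ g ≈ h → M₁ t f ∘ M₁ t g ≈ M₁ t h
  M-merge t p = ≈-trans (≈-sym (M-∘ t)) (M-≈ t p)

  Structure : Obj → Set ℓ
  Structure X = ∀ t → X ⇒ M₀ t X

  IsHom : ∀ {X Y} → Structure X → Structure Y → X ⇒ Y → Set ℓ
  IsHom γ δ h = ∀ t → M₁ t h ∘ γ t ≈ δ t ∘ h

  -- nothing stands for the unit law, just (s , t) for the multiplication
  -- law at s and t.
  Law : Set ℓ
  Law = Maybe (T × T)

  grade : Law → T
  grade nothing        = e
  grade (just (s , t)) = s · t

  lhs rhs : ∀ {X} → Structure X → ∀ i → X ⇒ M₀ (grade i) X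
  lhs γ i              = γ (grade i)
  rhs γ nothing        = η₀ _
  rhs γ (just (s , t)) = μ₀ s t _ ∘ (M₁ s (γ t) ∘ γ s)

  -- The unit case is naturality of `η`; for multiplication, naturality of `μ s t` is followed by
  -- `p t` under `M s` and then `p s`. It is stated for bare structures so that laws can be compared
  -- before they are known.
  rhs-natural : ∀ {X Y} {γ : Structure X} {δ : Structure Y} {h : X ⇒ Y} → IsHom γ δ h →
                ∀ i → M₁ (grade i) h ∘ rhs γ i ≈ rhs δ i ∘ h
  rhs-natural {h = h} p nothing = ≈-sym (NaturalTransformation.commute η h)
  rhs-natural {γ = γ} {δ} {h} p (just (s , t)) = begin
    M₁ (s · t) h ∘ (μ₀ s t _ ∘ (M₁ s (γ t) ∘ γ s))
      ≈⟨ pullˡ (≈-sym (NaturalTransformation.commute (μ s t) h)) ⟩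
    (μ₀ s t _ ∘ M₁ s (M₁ t h)) ∘ (M₁ s (γ t) ∘ γ s)
      ≈⟨ pullʳ (pullˡ (M-merge s (p t))) ⟩
    μ₀ s t _ ∘ (M₁ s (δ t ∘ h) ∘ γ s)
      ≈⟨ _ ∘⟨ (M-∘ s ⟩∘ _) ⟩
    μ₀ s t _ ∘ ((M₁ s (δ t) ∘ M₁ s h) ∘ γ s)
      ≈⟨ _ ∘⟨ pullʳ (p s) ⟩
    μ₀ s t _ ∘ (M₁ s (δ t) ∘ (δ s ∘ h))
      ≈⟨ ≈-trans assoc (_ ∘⟨ assoc) ⟨
    (μ₀ s t _ ∘ (M₁ s (δ t) ∘ δ s)) ∘ h ∎

  Lawful : ∀ {X} → Structure X → Set ℓ
  Lawful γ = ∀ i → lhs γ i ≈ rhs γ i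

  coalgebra : ∀ {X} (γ : Structure X) → Lawful γ → GradedCoalgebra 𝑀
  coalgebra γ laws = record
    { γ = γ ; γ-unit = laws nothing ; γ-mult = λ s t → laws (just (s , t)) }

  lawful : (A : GradedCoalgebra 𝑀) → Lawful (GradedCoalgebra.γ A)
  lawful A nothing        = GradedCoalgebra.γ-unit A
  lawful A (just (s , t)) = GradedCoalgebra.γ-mult A s t

  module _ {X Y} {γ : Structure X} {δ : Structure Y} {h : X ⇒ Y} (p : IsHom γ δ h)
           (i : Law) {Z} {f : Z ⇒ X} where

    lhs-along : M₁ (grade i) h ∘ (lhs γ i ∘ f) ≈ lhs δ i ∘ (h ∘ f)
    lhs-along = ≈-trans (pullˡ (p (grade i))) assoc

    rhs-along : M₁ (grade i) h ∘ (rhs γ i ∘ f) ≈ rhs δ i ∘ (h ∘ f)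
    rhs-along = ≈-trans (pullˡ (rhs-natural p i)) assoc

  carrier : Functor (GCoAlg 𝑀) C
  carrier = record
    { F₀           = GradedCoalgebra.X
    ; F₁           = CoalgebraHom.h
    ; identity     = Equiv.refl
    ; homomorphism = Equiv.refl
    ; F-resp-≈     = λ p → p
    }

  open CoalgebraHom

  carrier-reflectsColimits :
    {J : Category ℓ ℓ} (H : Functor J (GCoAlg 𝑀)) {N : GradedCoalgebra 𝑀} (K : Cocone H N) →
    IsColimit (carrier ∘F H) (mapCocone carrier K) → IsColimit H K
  carrier-reflectsColimits H {N} K isK = record
    { mediate = λ {Y} L →
        let m = mediate (mapCocone carrier L) in record
        { h       = m
        ; commute = λ t → jointly-epic isK λ j → begin
            (M₁ t m ∘ γ N t) ∘ h (Cocone.ψ K j)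
              ≈⟨ pullʳ (≈-sym (commute (Cocone.ψ K j) t)) ⟩
            M₁ t m ∘ (M₁ t (h (Cocone.ψ K j)) ∘ γ (Functor.F₀ H j) t)
              ≈⟨ pullˡ (M-merge t (factors (mapCocone carrier L) j)) ⟩
            M₁ t (h (Cocone.ψ L j)) ∘ γ (Functor.F₀ H j) t
              ≈⟨ commute (Cocone.ψ L j) t ⟩
            γ Y t ∘ h (Cocone.ψ L j)
              ≈⟨ pullʳ (factors (mapCocone carrier L) j) ⟨
            (γ Y t ∘ m) ∘ h (Cocone.ψ K j) ∎
        }
    ; factors = λ L → factors (mapCocone carrier L)
    ; unique  = λ L u → unique (mapCocone carrier L) (h u)
    }
    where
    open IsColimit isK
    open GradedCoalgebra using (γ)

  -- The structure maps in the diagram form a cocone on each `M₀ t N` and so induce `δ`; the laws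
  -- hold after every leg.
  GCoAlg-cocomplete : Cocomplete C → Cocomplete (GCoAlg 𝑀)
  GCoAlg-cocomplete cocomplete J H
    with N , K , isK ← cocomplete J (carrier ∘F H) =
    coalgebra δ laws , cocone , carrier-reflectsColimits H cocone record
      { mediate = λ L → mediate (copy L)
      ; factors = λ L → factors (copy L)
      ; unique  = λ L → unique (copy L)
      }
    where
    open IsColimit isK
    open Cocone K using (ψ) renaming (commute to ψ-commute)
    open Functor H
    open GradedCoalgebra using (γ)
    copy : ∀ {X} → Cocone (carrier ∘F H) X → Cocone (carrier ∘F H) X
    copy L = record { ψ = Cocone.ψ L ; commute = Cocone.commute L }
    structure : ∀ t → Cocone (carrier ∘F H) (M₀ t N)
    structure t = record
      { ψ       = λ j → M₁ t (ψ j) ∘ γ (F₀ j) t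
      ; commute = λ f → ≈-trans (pullʳ (≈-sym (commute (F₁ f) t)))
                                (pullˡ (M-merge t (ψ-commute f)))
      }
    δ : Structure N
    δ t = mediate (structure t)
    ψ-hom : ∀ j → IsHom (γ (F₀ j)) δ (ψ j)
    ψ-hom j t = ≈-sym (factors (structure t) j)
    laws : Lawful δ
    laws i = jointly-epic isK λ j → begin
      lhs δ i ∘ ψ j                        ≈⟨ ψ-hom j (grade i) ⟨
      M₁ (grade i) (ψ j) ∘ lhs (γ (F₀ j)) i ≈⟨ _ ∘⟨ lawful (F₀ j) i ⟩
      M₁ (grade i) (ψ j) ∘ rhs (γ (F₀ j)) i ≈⟨ rhs-natural (ψ-hom j) i ⟩
      rhs δ i ∘ ψ j                        ∎
    cocone : Cocone H (coalgebra δ laws)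
    cocone = record
      { ψ = λ j → record { h = ψ j ; commute = ψ-hom j } ; commute = ψ-commute }

-- Directed colimits of setoids

-- The given colimit `N` is compared with the setoid of germs, the usual explicit directed colimit,
-- through `mediate germs` and `realise`.
module DirectedSetoids
  (P : Poset ℓ ℓ ℓ) (F : Functor (posetCategory P) (Setoids ℓ))
  (join : ∀ i j → ∃ λ k → Poset._≤_ P i k × Poset._≤_ P j k)
  {N : Setoid ℓ ℓ} {K : Cocone F N} (isK : IsColimit F K) where

  open Poset P using (_≤_) renaming (trans to ≤-trans)
  open Functor F
  open Func using (to; cong)
  open Cocone K
  private
    module N = Setoid N
    module F₀ i = Setoid (F₀ i)

  ∣_∣ : Poset.Carrier P → Set ℓ
  ∣ i ∣ = F₀.Carrier i

  irrelevant : ∀ {i j} (l l′ : i ≤ j) (x : ∣ i ∣) → F₀._≈_ j (to (F₁ l) x) (to (F₁ l′) x)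
  irrelevant l l′ = F-resp-≈ {f = l} {g = l′} _

  Meets : ∀ {i j} → ∣ i ∣ → ∣ j ∣ → Set ℓ
  Meets {i} {j} x y = ∃ λ k → Σ (i ≤ k) λ l → Σ (j ≤ k) λ l′ →
                      F₀._≈_ k (to (F₁ l) x) (to (F₁ l′) y)

  push : ∀ {i j k m x y} {l : i ≤ k} {l′ : j ≤ k} → F₀._≈_ k (to (F₁ l) x) (to (F₁ l′) y) →
         (n : k ≤ m) → F₀._≈_ m (to (F₁ (≤-trans l n)) x) (to (F₁ (≤-trans l′ n)) y)
  push {m = m} {l = l} {l′} p n =
    F₀.trans m (homomorphism {f = l} {g = n} _) $
    F₀.trans m (cong (F₁ n) p) $
    F₀.sym m (homomorphism {f = l′} {g = n} _)

  Germs : Setoid ℓ ℓ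
  Germs = record
    { Carrier       = ∃ ∣_∣
    ; _≈_           = λ (_ , x) (_ , y) → Meets x y
    ; isEquivalence = record
      { refl  = λ {(i , _)} → i , Poset.refl P , Poset.refl P , F₀.refl i
      ; sym   = λ (k , l , l′ , p) → k , l′ , l , F₀.sym k p
      ; trans = λ (k , l , l′ , p) (k′ , n , n′ , q) →
          let m , a , b = join k k′ in
          m , ≤-trans l a , ≤-trans n′ b ,
          F₀.trans m (push p a)
            (F₀.trans m (irrelevant (≤-trans l′ a) (≤-trans n b) _) (push q b))
      }
    }

  germs : Cocone F Germs
  germs = record
    { ψ       = λ i → record
        { to   = i ,_
        ; cong = λ p → i , Poset.refl P , Poset.refl P , cong (F₁ (Poset.refl P)) p
        }
    ; commute = λ {i} {j} l x → j , Poset.refl P , l ,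
        F₀.trans j (F₀.sym j (homomorphism {f = l} {g = Poset.refl P} x))
                   (irrelevant (≤-trans l (Poset.refl P)) l x)
    }

  open IsColimit isK

  realise : Func Germs N
  realise = record
    { to   = λ (i , x) → to (ψ i) x
    ; cong = λ {(i , x)} {(j , y)} (k , l , l′ , p) →
        N.trans (N.sym (commute l x)) (N.trans (cong (ψ k) p) (commute l′ y))
    }

  -- `realise` after `mediate germs` fixes every leg, so it is the identity of `N`, and the germ of
  -- `n` yields a preimage.
  reach : ∀ n → ∃ λ i → ∃ λ (x : ∣ i ∣) → to (ψ i) x N.≈ n
  reach n = let i , x = to (mediate germs) n in i , x ,
    jointly-epic isK
      {u = Composition.function (mediate germs) realise}
      {v = record { to = λ n → n ; cong = λ p → p }}
      (λ j x → cong realise (factors germs j x)) n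

  -- `mediate germs` carries the equality in `N` to one of germs, which is agreement at a common
  -- later stage.
  meet : ∀ {i j} {x : ∣ i ∣} {y : ∣ j ∣} → to (ψ i) x N.≈ to (ψ j) y → Meets x y
  meet {i} {j} {x} {y} p =
    Germs.trans (Germs.sym (factors germs i x))
      (Germs.trans (cong (mediate germs) p) (factors germs j y))
    where module Germs = Setoid Germs

-- Colimits over subfamilies of a diagram

-- Boolean values keep the type of preorders in level `ℓ`; relations valued in `Set ℓ` would make
-- it, and with it the type of small coalgebras, large.
record Preorder𝔹 (A : Set ℓ) : Set ℓ where
  field
    rel       : A → A → Bool
    rel-refl  : ∀ {a} → IsTrue (rel a a)
    rel-trans : ∀ {a b c} → IsTrue (rel a b) → IsTrue (rel b c) → IsTrue (rel a c)

thin : {A : Set ℓ} → Preorder𝔹 A → Category ℓ ℓ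
thin {ℓ} {A} r = record
  { Obj       = A
  ; _⇒_       = λ a b → Lift ℓ (IsTrue (rel a b))
  ; _≈_       = λ _ _ → ⊤
  ; id        = lift rel-refl
  ; _∘_       = λ (lift m) (lift l) → lift (rel-trans l m)
  ; assoc     = _
  ; identityˡ = _
  ; identityʳ = _
  ; equiv     = _
  ; ∘-resp-≈  = _
  } where open Preorder𝔹 r

module Families
  (em : ∀ a → ExcludedMiddle a) {C : Category o ℓ} (cocomplete : Cocomplete C)
  {G : Set ℓ} (generator : G → Category.Obj C) (A : Set ℓ)
  (P : Poset ℓ ℓ ℓ) (F : Functor (posetCategory P) (Full C generator))
  {X : Category.Obj C} (K : Cocone (embed C generator ∘F F) X) (isK : IsColimit _ K)
  where
  open Category C
  open Reasoning C
  open Poset P using (_≤_) renaming (Carrier to ∣P∣; refl to ≤-refl; trans to ≤-trans)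
  open Functor F using (F₁)

  Family : Set ℓ
  Family = A → ∣P∣

  infix 4 _∈_ _⊑_

  _∈_ : ∣P∣ → Family → Set ℓ
  p ∈ x = ∃ λ a → x a ≡ p

  record _⊑_ (x y : Family) : Set ℓ where
    constructor ⊑-intro
    field apply : ∀ {p} → p ∈ x → p ∈ y

  open _⊑_ public

  ⊑-refl : ∀ {x} → x ⊑ x
  ⊑-refl = ⊑-intro λ m → m

  ⊑-trans : ∀ {x y z} → x ⊑ y → y ⊑ z → x ⊑ z
  ⊑-trans l l′ = ⊑-intro λ m → apply l′ (apply l m)

  F₀ : ∣P∣ → Obj
  F₀ p = generator (Functor.F₀ F p)

  induced : Family → Preorder𝔹 A
  induced x = record
    { rel       = λ a b → ⌊ em ℓ {x a ≤ x b} ⌋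
    ; rel-refl  = fromWitness ≤-refl
    ; rel-trans = λ l m → fromWitness (≤-trans (toWitness l) (toWitness m))
    }

  restrict : ∀ x → Functor (thin (induced x)) (posetCategory P)
  restrict x = record
    { F₀           = x
    ; F₁           = λ (lift l) → toWitness l
    ; identity     = _
    ; homomorphism = _
    ; F-resp-≈     = _
    }

  -- The shape is `A` preordered along `x`, not the image of `x`, so that shapes range over the
  -- small set `Preorder𝔹 A`. Indices with equal value are isomorphic in it, so only the image
  -- matters.
  sub : ∀ x → Colimit (embed C generator ∘F F ∘F restrict x)
  sub x = cocomplete _ _

  opaque
    ∣_∣ : Family → Obj
    ∣ x ∣ = proj₁ (sub x)

  F₁-irrelevant : ∀ {p q} (l l′ : p ≤ q) → F₁ l ≈ F₁ l′
  F₁-irrelevant l l′ = Functor.F-resp-≈ F {f = l} {g = l′} _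

  opaque
    unfolding ∣_∣
    inj : ∀ {p x} → p ∈ x → F₀ p ⇒ ∣ x ∣
    inj {x = x} (a , refl) = Cocone.ψ (proj₁ (proj₂ (sub x))) a

    inj-≤ : ∀ {p q x} (m : p ∈ x) (n : q ∈ x) (l : p ≤ q) → inj n ∘ F₁ l ≈ inj m
    inj-≤ {x = x} (a , refl) (b , refl) l =
      ≈-trans (_ ∘⟨ F₁-irrelevant _ _)
              (Cocone.commute (proj₁ (proj₂ (sub x))) (lift (fromWitness l)))

    inj-irrelevant : ∀ {p x} (m n : p ∈ x) → inj m ≈ inj n
    inj-irrelevant m n = ≈-trans (≈-sym (inj-≤ m n ≤-refl))
      (≈-trans (_ ∘⟨ Functor.identity F) identityʳ)

    inj-epic : ∀ {x Y} {u v : ∣ x ∣ ⇒ Y} →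
               (∀ {p} (m : p ∈ x) → u ∘ inj m ≈ v ∘ inj m) → u ≈ v
    inj-epic {x} h = jointly-epic (proj₂ (proj₂ (sub x))) λ a → h (a , refl)

  module _ {x Y} (v : ∀ {p} → p ∈ x → F₀ p ⇒ Y)
           (v-≤ : ∀ {p q} (m : p ∈ x) (n : q ∈ x) (l : p ≤ q) → v n ∘ F₁ l ≈ v m) where

    private
      L : Cocone (embed C generator ∘F F ∘F restrict x) Y
      L = record { ψ = λ a → v (a , refl) ; commute = λ _ → v-≤ _ _ _ }

    opaque
      unfolding ∣_∣ inj
      extend : ∣ x ∣ ⇒ Y
      extend = IsColimit.mediate (proj₂ (proj₂ (sub x))) L

      extend-inj : ∀ {p} (m : p ∈ x) → extend ∘ inj m ≈ v m
      extend-inj (a , refl) = IsColimit.factors (proj₂ (proj₂ (sub x))) L a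

  opaque
    inc : ∀ {x y} → x ⊑ y → ∣ x ∣ ⇒ ∣ y ∣
    inc l = extend (λ m → inj (apply l m)) (λ m n → inj-≤ (apply l m) (apply l n))

    inc-inj : ∀ {x y} (l : x ⊑ y) {p} (m : p ∈ x) (n : p ∈ y) → inc l ∘ inj m ≈ inj n
    inc-inj l m n = ≈-trans
      (extend-inj (λ m → inj (apply l m)) (λ m n → inj-≤ (apply l m) (apply l n)) m)
      (inj-irrelevant (apply l m) n)

    inc-∘ : ∀ {x y z} (l : x ⊑ y) (m : y ⊑ z) (n : x ⊑ z) → inc m ∘ inc l ≈ inc n
    inc-∘ l m n = inj-epic λ k →
      ≈-trans (pullʳ (inc-inj l k (apply l k)))
              (≈-trans (inc-inj m (apply l k) (apply n k)) (≈-sym (inc-inj n k (apply n k))))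

    inc-irrelevant : ∀ {x y} (l m : x ⊑ y) → inc l ≈ inc m
    inc-irrelevant l m = inj-epic λ k →
      ≈-trans (inc-inj l k (apply l k)) (≈-sym (inc-inj m k (apply l k)))

    inc-id : ∀ {x} (l : x ⊑ x) → inc l ≈ id
    inc-id l = inj-epic λ k → ≈-trans (inc-inj l k k) (≈-sym identityˡ)

    ι : ∀ x → ∣ x ∣ ⇒ X
    ι x = extend (λ {p} _ → Cocone.ψ K p) (λ _ _ l → Cocone.commute K l)

    ι-inj : ∀ {x p} (m : p ∈ x) → ι x ∘ inj m ≈ Cocone.ψ K p
    ι-inj = extend-inj (λ {p} _ → Cocone.ψ K p) (λ _ _ l → Cocone.commute K l)

    ι-inc : ∀ {x y} (l : x ⊑ y) → ι y ∘ inc l ≈ ι x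
    ι-inc l = inj-epic λ k →
      ≈-trans (pullʳ (inc-inj l k (apply l k)))
              (≈-trans (ι-inj (apply l k)) (≈-sym (ι-inj k)))

  inclusionPoset : {W : Set ℓ} → (W → Family) → Poset ℓ ℓ ℓ
  inclusionPoset {W} fam = record
    { Carrier        = W
    ; _≈_            = λ v w → fam v ⊑ fam w × fam w ⊑ fam v
    ; _≤_            = λ v w → fam v ⊑ fam w
    ; isPartialOrder = record
      { isPreorder = record
        { isEquivalence = record
          { refl  = ⊑-refl , ⊑-refl
          ; sym   = λ (l , l′) → l′ , l
          ; trans = λ (l , l′) (m , m′) → ⊑-trans l m , ⊑-trans m′ l′
          }
        ; reflexive = proj₁
        ; trans     = ⊑-trans
        }
      ; antisym = _,_
      }
    }

  module _ {W : Set ℓ} (fam : W → Family) where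

    subs : Functor (posetCategory (inclusionPoset fam)) C
    subs = record
      { F₀           = λ w → ∣ fam w ∣
      ; F₁           = inc
      ; identity     = inc-id ⊑-refl
      ; homomorphism = λ {_} {_} {_} {l} {m} → ≈-sym (inc-∘ l m (⊑-trans l m))
      ; F-resp-≈     = λ {_} {_} {l} {m} _ → inc-irrelevant l m
      }

    ι-cocone : Cocone subs X
    ι-cocone = record { ψ = λ w → ι (fam w) ; commute = λ l → ι-inc l }

    module _ (hull : ∣P∣ → W) (∈-hull : ∀ {p} → p ∈ fam (hull p))
             (hull-least : ∀ {p w} → p ∈ fam w → fam (hull p) ⊑ fam w)
             (both : ∀ p q → ∃ λ w → p ∈ fam w × q ∈ fam w) where

      -- A cocone `L` is read off at `p` from its leg at `hull p`. As the hull is least, any member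
      -- containing `p` gives the same map (`local`); a member containing both ends of `p ≤ q` then
      -- yields compatibility.
      ι-isColimit : IsColimit subs ι-cocone
      ι-isColimit = record
        { mediate = λ L → IsColimit.mediate isK (flat L)
        ; factors = λ L w → inj-epic λ {p} m → begin
            (IsColimit.mediate isK (flat L) ∘ ι (fam w)) ∘ inj m ≈⟨ pullʳ (ι-inj m) ⟩
            IsColimit.mediate isK (flat L) ∘ Cocone.ψ K p ≈⟨ IsColimit.factors isK (flat L) p ⟩
            Cocone.ψ L (hull p) ∘ inj ∈-hull             ≈⟨ local L m ⟨
            Cocone.ψ L w ∘ inj m                         ∎
        ; unique  = λ L u h → IsColimit.unique isK (flat L) u λ p → begin
            u ∘ Cocone.ψ K p                     ≈⟨ _ ∘⟨ ι-inj ∈-hull ⟨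
            u ∘ (ι (fam (hull p)) ∘ inj ∈-hull)  ≈⟨ pullˡ (h (hull p)) ⟩
            Cocone.ψ L (hull p) ∘ inj ∈-hull     ∎
        }
        where
        local : ∀ {Y} (L : Cocone subs Y) {p w} (m : p ∈ fam w) →
                Cocone.ψ L w ∘ inj m ≈ Cocone.ψ L (hull p) ∘ inj ∈-hull
        local L {p} {w} m = begin
          Cocone.ψ L w ∘ inj m
            ≈⟨ _ ∘⟨ inc-inj (hull-least m) ∈-hull m ⟨
          Cocone.ψ L w ∘ (inc (hull-least m) ∘ inj ∈-hull)
            ≈⟨ pullˡ (Cocone.commute L (hull-least m)) ⟩
          Cocone.ψ L (hull p) ∘ inj ∈-hull ∎
        flat : ∀ {Y} → Cocone subs Y → Cocone (embed C generator ∘F F) Y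
        flat L = record
          { ψ       = λ p → Cocone.ψ L (hull p) ∘ inj ∈-hull
          ; commute = λ {p} {q} l → let w , m , n = both p q in begin
              (Cocone.ψ L (hull q) ∘ inj ∈-hull) ∘ F₁ l ≈⟨ local L n ⟩∘ _ ⟨
              (Cocone.ψ L w ∘ inj n) ∘ F₁ l             ≈⟨ pullʳ (inj-≤ m n l) ⟩
              Cocone.ψ L w ∘ inj m                      ≈⟨ local L m ⟩
              Cocone.ψ L (hull p) ∘ inj ∈-hull          ∎
          }

-- Generation by small coalgebras

-- An index set closed under the coding of pairs and of finite trees over
-- itself: copy a codes the leaf a, and node a b c codes the node labelled c
-- with subtrees a and b.
data Index (B : Set ℓ) : Set ℓ where
  base : B → Index B
  copy : Index B → Index B
  node : Index B → Index B → Index B → Index B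

-- Each value of `D` is a whole family, yet `D` has only two arguments, so finite trees reach
-- everything and the closure is again indexed by `Index B`.
module Closure {A B : Set ℓ} (D : A → A → Index B → A) where

  Closed : (Index B → A) → Set ℓ
  Closed y = ∀ {p q r} → (∃ λ a → y a ≡ p) → (∃ λ a → y a ≡ q) →
             (∃ λ a → D p q a ≡ r) → ∃ λ a → y a ≡ r

  closure : (Index B → A) → Index B → A
  -- `base b` codes no tree; its value must lie in `x` to keep the closure least.
  closure x (base b)     = x (base b)
  closure x (copy a)     = x a
  closure x (node a b c) = D (closure x a) (closure x b) c

  closure-closed : ∀ x → Closed (closure x)
  closure-closed x (a , refl) (b , refl) (c , refl) = node a b c , refl

  closure-least : ∀ {x y} → Closed y → (∀ a → ∃ λ b → y b ≡ x a) →
                  ∀ a → ∃ λ b → y b ≡ closure x a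
  closure-least c l (base b)      = l (base b)
  closure-least c l (copy a)      = l a
  closure-least c l (node a b c′) = c (closure-least c l a) (closure-least c l b) (c′ , refl)

module Generation
  (em : ∀ a → ExcludedMiddle a)
  {T : Set ℓ} {_·_ : T → T → T} {e : T} {T-monoid : IsMonoid _≡_ _·_ e}
  {C : Category o ℓ} (cocomplete : Cocomplete C)
  {κ : RegularCardinal ℓ} (accessible : IsAccessibleAt C κ)
  (𝑀 : GradedMonad T-monoid C)
  (M-accessible : ∀ t → IsAccessibleFunctor (GradedMonad.M 𝑀 t))
  where
  open Category C
  open Reasoning C
  open GradedMonad 𝑀
  open IsAccessibleAt accessible

  -- The summands make room in `A` for `κ`, for the cardinal of every `M t` and for the grades,
  -- hence for all laws. The grade `e` also makes `A` inhabited.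
  B : Set ℓ
  B = ∣κ∣ κ ⊎ (Σ T λ t → ∣κ∣ (proj₁ (M-accessible t))) ⊎ T

  A : Set ℓ
  A = Index B

  code : T → A
  code t = base (inj₂ (inj₂ t))

  κ↣A : ∣κ∣ κ ↣ A
  κ↣A = mk↣ {to = λ k → base (inj₁ k)} λ { refl → refl }

  κₜ↣A : ∀ t → ∣κ∣ (proj₁ (M-accessible t)) ↣ A
  κₜ↣A t = mk↣ {to = λ k → base (inj₂ (inj₁ (t , k)))} λ { refl → refl }

  T↣A : T ↣ A
  T↣A = mk↣ {to = code} λ { refl → refl }

  Law↣A : Law 𝑀 ↣ A
  Law↣A = mk↣ {to = λ { nothing → code e ; (just (s , t)) → node (code s) (code t) (code e) }}
    λ { {nothing} {nothing} _ → refl ; {nothing} {just _} () ; {just _} {nothing} ()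
      ; {just _} {just _} refl → refl }

  Bool↣A : Lift ℓ Bool ↣ A
  Bool↣A = mk↣ {to = λ { (lift false) → code e ; (lift true) → copy (code e) }}
    λ { {lift false} {lift false} _ → refl ; {lift false} {lift true} ()
      ; {lift true} {lift false} () ; {lift true} {lift true} _ → refl }

  -- The carrier is computed from a diagram rather than stored, since the objects of `C` live in
  -- level `o`; every field lives in level `ℓ`.
  record SmallCoalgebra : Set ℓ where
    field
      order   : Preorder𝔹 A
      diagram : Functor (thin order) (Full C generator)

    object : Obj
    object = proj₁ (cocomplete _ (embed C generator ∘F diagram))

    field
      structure : Structure 𝑀 object
      laws      : Lawful 𝑀 structure

  ⟦_⟧ : SmallCoalgebra → GradedCoalgebra 𝑀
  ⟦ S ⟧ = coalgebra 𝑀 (SmallCoalgebra.structure S) (SmallCoalgebra.laws S)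

  module Cover
    (Y : GradedCoalgebra 𝑀) (P : Poset ℓ ℓ ℓ) (directed : IsDirected κ P)
    (F : Functor (posetCategory P) (Full C generator))
    (K : Cocone (embed C generator ∘F F) (GradedCoalgebra.X Y)) (isK : IsColimit _ K)
    where
    open GradedCoalgebra Y using (X; γ)
    open Families em cocomplete generator A P F K isK
    open Poset P using (_≤_) renaming (Carrier to ∣P∣; refl to ≤-refl)
    open Functor F using (F₁)
    open Cocone K using (ψ)

    p₀ : ∣P∣
    -- The infinite set `∣κ∣ κ` has an element, so the empty set is strictly smaller and the empty
    -- family has a bound.
    p₀ = proj₁ (directed (Lift ℓ ⊥) ((mk↣ {to = λ ()} λ { {()} }) , λ f →
      lower (Injection.to f (Injection.to (RegularCardinal.infinite κ) zero))) λ ())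

    module _ {I : Set ℓ} (code : I ↣ A) (x : I → Family) where

      opaque
        decode : ∀ {a} → Dec (∃ λ i → Injection.to code i ≡ a) → Family
        decode (yes (i , _)) = x i
        decode (no _)        = λ _ → p₀

        -- At `node a b _`, the index `a` codes some `i` in `I`, and `b` is an index of `x i`. The
        -- default `p₀` may be added, so this is an upper bound rather than an exact union.
        union : Family
        union (node a b _) = decode {a} (em ℓ) b
        union _            = p₀

        decode-code : ∀ i (d : Dec (∃ λ j → Injection.to code j ≡ Injection.to code i)) →
                      x i ⊑ decode d
        decode-code i (yes (j , p)) with refl ← Injection.injective code p = ⊑-refl
        decode-code i (no ¬p) = ⊥-elim (¬p (i , refl))

        ⊑-union : ∀ i → x i ⊑ union
        ⊑-union i = ⊑-intro λ m → let b , p = apply (decode-code i (em ℓ)) m in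
                    node (Injection.to code i) b b , p

    infixr 6 _∪_

    opaque
      _∪_ : Family → Family → Family
      x ∪ y = union Bool↣A λ { (lift false) → x ; (lift true) → y }

      ⊑-∪ˡ : ∀ {x y} → x ⊑ x ∪ y
      ⊑-∪ˡ = ⊑-union _ _ (lift false)

      ⊑-∪ʳ : ∀ {x y} → y ⊑ x ∪ y
      ⊑-∪ʳ = ⊑-union _ _ (lift true)

    single : ∣P∣ → Family
    single p _ = p

    ∈-single : ∀ {p} → p ∈ single p
    ∈-single = code e , refl

    single-⊑ : ∀ {p x} → p ∈ x → single p ⊑ x
    single-⊑ m = ⊑-intro λ { (_ , refl) → m }

    families : Poset ℓ ℓ ℓ
    families = inclusionPoset (λ x → x)

    -- A set smaller than `κ′` injects into `A`, so `union` bounds its families. One poset is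
    -- thereby directed for `κ` and for the cardinals of all `M t`.
    families-directed : ∀ κ′ → ∣κ∣ κ′ ↣ A → IsDirected κ′ families
    families-directed κ′ c I (f , _) x = union (Composition.injection f c) x , ⊑-union _ x

    X-isColimit : IsColimit (subs (λ x → x)) (ι-cocone (λ x → x))
    X-isColimit = ι-isColimit (λ x → x) single ∈-single single-⊑
      λ p q → single p ∪ single q , apply ⊑-∪ˡ ∈-single , apply ⊑-∪ʳ ∈-single

    -- `M t` preserves the colimit `X` of all `∣ x ∣`, and the hom functor of the presentable object
    -- `F₀ p` preserves the resulting one; maps from `F₀ p` to `M₀ t X` are therefore germs.
    module Presented p t = DirectedSetoids families
      (Hom[ F₀ p ,-] ∘F M t ∘F subs (λ x → x))
      (λ x y → x ∪ y , ⊑-∪ˡ , ⊑-∪ʳ)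
      (presentable (Functor.F₀ F p) families (families-directed κ κ↣A) _ _
        (proj₂ (M-accessible t) families (families-directed (proj₁ (M-accessible t)) (κₜ↣A t)) _ _ X-isColimit))

    opaque
      factor : ∀ {p t} (f : F₀ p ⇒ M₀ t X) →
               ∃ λ x → ∃ λ (g : F₀ p ⇒ M₀ t ∣ x ∣) → M₁ t (ι x) ∘ g ≈ f
      factor = Presented.reach _ _

      inc-resp : ∀ {p t x y z} {f g : F₀ p ⇒ M₀ t ∣ x ∣} (l : x ⊑ y) (m : y ⊑ z) (n : x ⊑ z) →
                 M₁ t (inc l) ∘ f ≈ M₁ t (inc l) ∘ g → M₁ t (inc n) ∘ f ≈ M₁ t (inc n) ∘ g
      inc-resp {t = t} l m n h =
        ≈-trans (≈-sym (pullˡ (M-merge 𝑀 t (inc-∘ l m n))))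
                (≈-trans (_ ∘⟨ h) (pullˡ (M-merge 𝑀 t (inc-∘ l m n))))

      identify : ∀ {p t x} (f g : F₀ p ⇒ M₀ t ∣ x ∣) → M₁ t (ι x) ∘ f ≈ M₁ t (ι x) ∘ g →
                 ∃ λ y → Σ (x ⊑ y) λ l → M₁ t (inc l) ∘ f ≈ M₁ t (inc l) ∘ g
      identify {p} {t} {x} f g h =
        let y , l , l′ , q = Presented.meet p t {x} {x} {f} {g} h in
        y , l , ≈-trans q (M-≈ 𝑀 t (inc-irrelevant l′ l) ⟩∘ g)

      -- The bounds for the separate `i` are joined, as `I` injects into `A`; adding `x` makes its
      -- inclusion independent of `i`.
      identify-all : ∀ {I : Set ℓ} → I ↣ A → (t : I → T) → ∀ {p x}
                     (f g : ∀ i → F₀ p ⇒ M₀ (t i) ∣ x ∣) →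
                     (∀ i → M₁ (t i) (ι x) ∘ f i ≈ M₁ (t i) (ι x) ∘ g i) →
                     ∃ λ y → Σ (x ⊑ y) λ l → ∀ i → M₁ (t i) (inc l) ∘ f i ≈ M₁ (t i) (inc l) ∘ g i
      identify-all code t {x = x} f g h =
        let y = λ i → identify (f i) (g i) (h i)
            u = union code (λ i → proj₁ (y i))
        in x ∪ u , ⊑-∪ˡ , λ i →
           inc-resp (proj₁ (proj₂ (y i))) (⊑-trans (⊑-union code (λ i → proj₁ (y i)) i) ⊑-∪ʳ) ⊑-∪ˡ
             (proj₂ (proj₂ (y i)))

    -- Factorizations of the structure maps of `Y` and their compatibility.

    module _ (p : ∣P∣) where

      private
        lifts : ∀ t → ∃ λ x → ∃ λ (g : F₀ p ⇒ M₀ t ∣ x ∣) → M₁ t (ι x) ∘ g ≈ γ t ∘ ψ p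
        lifts t = factor (γ t ∘ ψ p)

      opaque
        support : Family
        support = union T↣A (λ t → proj₁ (lifts t))

        γ̂ : ∀ t → F₀ p ⇒ M₀ t ∣ support ∣
        γ̂ t = M₁ t (inc (⊑-union T↣A (λ t → proj₁ (lifts t)) t)) ∘ proj₁ (proj₂ (lifts t))

        ι-γ̂ : ∀ t → M₁ t (ι support) ∘ γ̂ t ≈ γ t ∘ ψ p
        ι-γ̂ t = ≈-trans (pullˡ (M-merge 𝑀 t (ι-inc _))) (proj₂ (proj₂ (lifts t)))

    -- The maps `γ̂` at `p` and `q` are chosen separately and agree along `p ≤ q` only in `X`; in
    -- such a `y` they already agree. The condition is vacuous when `p ≤ q` fails, so `R` is defined
    -- on all pairs.
    record Reconciles (p q : ∣P∣) (y : Family) : Set ℓ where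
      field
        left  : support p ⊑ y
        right : support q ⊑ y
        agree : ∀ (l : p ≤ q) t →
                M₁ t (inc right) ∘ (γ̂ q t ∘ F₁ l) ≈ M₁ t (inc left) ∘ γ̂ p t

    module _ {p q} (l : p ≤ q) {x} (a : support p ⊑ x) (b : support q ⊑ x) where

      agree-in-X : ∀ t → M₁ t (ι x) ∘ (M₁ t (inc b) ∘ (γ̂ q t ∘ F₁ l)) ≈
                         M₁ t (ι x) ∘ (M₁ t (inc a) ∘ γ̂ p t)
      agree-in-X t = begin
        M₁ t (ι x) ∘ (M₁ t (inc b) ∘ (γ̂ q t ∘ F₁ l)) ≈⟨ pullˡ (M-merge 𝑀 t (ι-inc b)) ⟩
        M₁ t (ι (support q)) ∘ (γ̂ q t ∘ F₁ l)        ≈⟨ pullˡ (ι-γ̂ q t) ⟩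
        (γ t ∘ ψ q) ∘ F₁ l                           ≈⟨ pullʳ (Cocone.commute K l) ⟩
        γ t ∘ ψ p                                    ≈⟨ ι-γ̂ p t ⟨
        M₁ t (ι (support p)) ∘ γ̂ p t                 ≈⟨ pullˡ (M-merge 𝑀 t (ι-inc a)) ⟨
        M₁ t (ι x) ∘ (M₁ t (inc a) ∘ γ̂ p t)          ∎

      reconciles : ∀ {y} (n : x ⊑ y) →
        (∀ t → M₁ t (inc n) ∘ (M₁ t (inc b) ∘ (γ̂ q t ∘ F₁ l)) ≈
               M₁ t (inc n) ∘ (M₁ t (inc a) ∘ γ̂ p t)) →
        Reconciles p q y
      reconciles n h = record
        { left  = ⊑-trans a n
        ; right = ⊑-trans b n
        ; agree = λ l′ t → begin
            M₁ t (inc (⊑-trans b n)) ∘ (γ̂ q t ∘ F₁ l′)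
              ≈⟨ _ ∘⟨ _ ∘⟨ F₁-irrelevant l′ l ⟩
            M₁ t (inc (⊑-trans b n)) ∘ (γ̂ q t ∘ F₁ l)
              ≈⟨ pullˡ (M-merge 𝑀 t (inc-∘ b n (⊑-trans b n))) ⟨
            M₁ t (inc n) ∘ (M₁ t (inc b) ∘ (γ̂ q t ∘ F₁ l))
              ≈⟨ h t ⟩
            M₁ t (inc n) ∘ (M₁ t (inc a) ∘ γ̂ p t)
              ≈⟨ pullˡ (M-merge 𝑀 t (inc-∘ a n (⊑-trans a n))) ⟩
            M₁ t (inc (⊑-trans a n)) ∘ γ̂ p t ∎
        }

    reconcile : ∀ p q → Dec (p ≤ q) → ∃ (Reconciles p q)
    reconcile p q (no ¬l) = support p ∪ support q , record
      { left = ⊑-∪ˡ ; right = ⊑-∪ʳ ; agree = λ l → ⊥-elim (¬l l) }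
    reconcile p q (yes l)
      with y , n , h ← identify-all T↣A (λ t → t)
             (λ t → M₁ t (inc ⊑-∪ʳ) ∘ (γ̂ q t ∘ F₁ l)) (λ t → M₁ t (inc ⊑-∪ˡ) ∘ γ̂ p t)
             (agree-in-X l ⊑-∪ˡ ⊑-∪ʳ) =
      y , reconciles l ⊑-∪ˡ ⊑-∪ʳ n h

    opaque
      R : ∣P∣ → ∣P∣ → Family
      R p q = proj₁ (reconcile p q (em ℓ))

      R-reconciles : ∀ p q → Reconciles p q (R p q)
      R-reconciles p q = proj₂ (reconcile p q (em ℓ))

    module R p q = Reconciles (R-reconciles p q)

    -- Coalgebra structure maps on families closed under `R`.

    open Closure R using (Closed; closure; closure-closed; closure-least)

    opaque
      R-⊑ : ∀ {x p q} → Closed x → p ∈ x → q ∈ x → R p q ⊑ x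
      R-⊑ c m n = ⊑-intro (c m n)

      support-⊑ : ∀ {x p} → Closed x → p ∈ x → support p ⊑ x
      -- Closure under `R` covers supports as well, since `R p p` contains `support p`.
      support-⊑ {p = p} c m = ⊑-trans (R.left p p) (R-⊑ c m m)

    module _ {x} (c : Closed x) where

      private
        v : ∀ t {p} → p ∈ x → F₀ p ⇒ M₀ t ∣ x ∣
        v t {p} m = M₁ t (inc (support-⊑ c m)) ∘ γ̂ p t

        -- Both sides factor through `M₀ t ∣ R p q ∣` and agree there; closedness gives `R p q ⊑ x`.
        v-≤ : ∀ t {p q} (m : p ∈ x) (n : q ∈ x) (l : p ≤ q) → v t n ∘ F₁ l ≈ v t m
        v-≤ t {p} {q} m n l = begin
          v t n ∘ F₁ l
            ≈⟨ assoc ⟩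
          M₁ t (inc (support-⊑ c n)) ∘ (γ̂ q t ∘ F₁ l)
            ≈⟨ pullˡ (M-merge 𝑀 t (inc-∘ (R.right p q) k _)) ⟨
          M₁ t (inc k) ∘ (M₁ t (inc (R.right p q)) ∘ (γ̂ q t ∘ F₁ l))
            ≈⟨ _ ∘⟨ R.agree p q l t ⟩
          M₁ t (inc k) ∘ (M₁ t (inc (R.left p q)) ∘ γ̂ p t)
            ≈⟨ pullˡ (M-merge 𝑀 t (inc-∘ (R.left p q) k _)) ⟩
          v t m ∎
          where
          k : R p q ⊑ x
          k = R-⊑ c m n

      opaque
        δ : Structure 𝑀 ∣ x ∣
        δ t = extend (v t) (v-≤ t)

        δ-inj : ∀ t {p} (m : p ∈ x) (l : support p ⊑ x) → δ t ∘ inj m ≈ M₁ t (inc l) ∘ γ̂ p t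
        δ-inj t m l = ≈-trans (extend-inj (v t) (v-≤ t) m) (M-≈ 𝑀 t (inc-irrelevant _ l) ⟩∘ _)

        ι-hom : IsHom 𝑀 δ γ (ι x)
        ι-hom t = inj-epic λ {p} m → begin
          (M₁ t (ι x) ∘ δ t) ∘ inj m      ≈⟨ pullʳ (δ-inj t m _) ⟩
          M₁ t (ι x) ∘ v t m              ≈⟨ pullˡ (M-merge 𝑀 t (ι-inc _)) ⟩
          M₁ t (ι (support p)) ∘ γ̂ p t    ≈⟨ ι-γ̂ p t ⟩
          γ t ∘ ψ p                       ≈⟨ pullʳ (ι-inj m) ⟨
          (γ t ∘ ι x) ∘ inj m             ∎

    -- On the leg at `p`, both structures are images of the same map `γ̂ p t`, whichever closed
    -- families are chosen.
    inc-hom : ∀ {x y} (c : Closed x) (d : Closed y) (l : x ⊑ y) →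
              IsHom 𝑀 (δ c) (δ d) (inc l)
    inc-hom c d l t = inj-epic λ {p} m → begin
      (M₁ t (inc l) ∘ δ c t) ∘ inj m
        ≈⟨ pullʳ (δ-inj c t m (support-⊑ c m)) ⟩
      M₁ t (inc l) ∘ (M₁ t (inc (support-⊑ c m)) ∘ γ̂ p t)
        ≈⟨ pullˡ (M-merge 𝑀 t (inc-∘ _ l (⊑-trans (support-⊑ c m) l))) ⟩
      M₁ t (inc (⊑-trans (support-⊑ c m) l)) ∘ γ̂ p t
        ≈⟨ δ-inj d t (apply l m) _ ⟨
      δ d t ∘ inj (apply l m)
        ≈⟨ pullʳ (inc-inj l m _) ⟨
      (δ d t ∘ inc l) ∘ inj m ∎

    -- Closed families on which the coalgebra laws hold.

    module _ (p : ∣P∣) where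

      cl : Family
      cl = closure (single p)

      cl-closed : Closed cl
      cl-closed = closure-closed (single p)

      ∈-cl : p ∈ cl
      ∈-cl = copy (code e) , refl

      opaque
        -- `ι` is a homomorphism into the lawful `Y`, so both sides of each law agree in `X`, hence
        -- above some `y`, common to all laws since these inject into `A`. As `cl p` is the least
        -- closed family containing `p`, the result passes to all others.
        lawful-above : ∃ λ y → Σ (cl ⊑ y) λ l → ∀ i →
          M₁ (grade 𝑀 i) (inc l) ∘ (lhs 𝑀 (δ cl-closed) i ∘ inj ∈-cl) ≈
          M₁ (grade 𝑀 i) (inc l) ∘ (rhs 𝑀 (δ cl-closed) i ∘ inj ∈-cl)
        lawful-above = identify-all Law↣A (grade 𝑀)
          (λ i → lhs 𝑀 (δ cl-closed) i ∘ inj ∈-cl) (λ i → rhs 𝑀 (δ cl-closed) i ∘ inj ∈-cl)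
          λ i → ≈-trans (lhs-along 𝑀 (ι-hom cl-closed) i)
               (≈-trans (lawful 𝑀 Y i ⟩∘ _) (≈-sym (rhs-along 𝑀 (ι-hom cl-closed) i)))

    cl-⊑ : ∀ {p x} → Closed x → p ∈ x → cl p ⊑ x
    cl-⊑ c m = ⊑-intro λ { (a , refl) → closure-least c (λ _ → m) a }

    -- Closure under R alone carries the structure maps, and closure under S
    -- also the laws.
    S : ∣P∣ → ∣P∣ → Family
    S p q = R p q ∪ proj₁ (lawful-above p)

    module S = Closure S

    S-closed⇒closed : ∀ {x} → S.Closed x → Closed x
    S-closed⇒closed c m n k = c m n (apply ⊑-∪ˡ k)

    δ-lawful : ∀ {x} (c : S.Closed x) → Lawful 𝑀 (δ (S-closed⇒closed c))
    δ-lawful {x} c i = inj-epic λ {p} m →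
      let y , k , h = lawful-above p
          -- `S p p` contains the `y` of `lawful-above p`, hence `m` twice.
          l : y ⊑ x
          l = ⊑-intro λ n → c m m (apply ⊑-∪ʳ n)
          n : cl p ⊑ x
          n = cl-⊑ (S-closed⇒closed c) m
          hom = inc-hom (cl-closed p) (S-closed⇒closed c) n
      in begin
        lhs 𝑀 (δ (S-closed⇒closed c)) i ∘ inj m
          ≈⟨ _ ∘⟨ inc-inj n (∈-cl p) m ⟨
        lhs 𝑀 (δ (S-closed⇒closed c)) i ∘ (inc n ∘ inj (∈-cl p))
          ≈⟨ lhs-along 𝑀 hom i ⟨
        M₁ (grade 𝑀 i) (inc n) ∘ (lhs 𝑀 (δ (cl-closed p)) i ∘ inj (∈-cl p))
          -- `y` need not be closed and carries no structure; only the equation is moved from `y` to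
          -- `x`.
          ≈⟨ inc-resp k l n (h i) ⟩
        M₁ (grade 𝑀 i) (inc n) ∘ (rhs 𝑀 (δ (cl-closed p)) i ∘ inj (∈-cl p))
          ≈⟨ rhs-along 𝑀 hom i ⟩
        rhs 𝑀 (δ (S-closed⇒closed c)) i ∘ (inc n ∘ inj (∈-cl p))
          ≈⟨ _ ∘⟨ inc-inj n (∈-cl p) m ⟩
        rhs 𝑀 (δ (S-closed⇒closed c)) i ∘ inj m ∎

    -- `Y` as a colimit of small coalgebras.

    ClosedFamily : Set ℓ
    ClosedFamily = Σ Family S.Closed

    family : ClosedFamily → Family
    family = proj₁

    closeds : Poset ℓ ℓ ℓ
    closeds = inclusionPoset family

    S-closure-⊑ : ∀ {x y} → S.Closed y → x ⊑ y → S.closure x ⊑ y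
    S-closure-⊑ c l = ⊑-intro λ { (a , refl) → S.closure-least c (λ b → apply l (b , refl)) a }

    ∈-S-closure : ∀ {p x} → p ∈ x → p ∈ S.closure x
    ∈-S-closure (a , refl) = copy a , refl

    closeds-isColimit : IsColimit (subs family) (ι-cocone family)
    closeds-isColimit = ι-isColimit family
      (λ p → S.closure (single p) , S.closure-closed _)
      (∈-S-closure ∈-single)
      (λ {_} {(_ , c)} m → S-closure-⊑ c (single-⊑ m))
      (λ p q → (S.closure (single p ∪ single q) , S.closure-closed _) ,
        ∈-S-closure (apply ⊑-∪ˡ ∈-single) , ∈-S-closure (apply ⊑-∪ʳ ∈-single))

    opaque
      -- `∣ x ∣` has to unfold to `object`, the colimit that `cocomplete` chooses for the same
      -- diagram.
      unfolding ∣_∣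

      smalls : Functor (posetCategory closeds) (Full (GCoAlg 𝑀) ⟦_⟧)
      smalls = record
        { F₀           = λ (x , c) → record
          { order     = induced x
          ; diagram   = F ∘F restrict x
          ; structure = δ (S-closed⇒closed c)
          ; laws      = δ-lawful c
          }
        ; F₁           = λ l → record { h = inc l ; commute = inc-hom _ _ l }
        ; identity     = inc-id ⊑-refl
        ; homomorphism = λ {_} {_} {_} {l} {m} → ≈-sym (inc-∘ l m (⊑-trans l m))
        ; F-resp-≈     = λ {_} {_} {l} {m} _ → inc-irrelevant l m
        }

      cover : Cocone (embed (GCoAlg 𝑀) ⟦_⟧ ∘F smalls) Y
      cover = record
        { ψ       = λ (x , c) → record { h = ι x ; commute = ι-hom (S-closed⇒closed c) }
        ; commute = λ l → ι-inc l
        }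

      cover-isColimit : IsColimit _ cover
      cover-isColimit = carrier-reflectsColimits 𝑀 _ cover record
        { mediate = λ L → mediate (copy′ L)
        ; factors = λ L → factors (copy′ L)
        ; unique  = λ L → unique (copy′ L)
        }
        where
        open IsColimit closeds-isColimit
        copy′ : ∀ {Z} → Cocone (carrier 𝑀 ∘F embed (GCoAlg 𝑀) ⟦_⟧ ∘F smalls) Z →
                Cocone (subs family) Z
        copy′ L = record { ψ = Cocone.ψ L ; commute = λ {v} {w} → Cocone.commute L {v} {w} }

  GCoAlg-colimitGenerated : ColimitGenerated (GCoAlg 𝑀)
  GCoAlg-colimitGenerated = SmallCoalgebra , ⟦_⟧ , λ Y →
    let P , F , K , directed , isGenerator , isK = generates (GradedCoalgebra.X Y)
        module L = Relabel generator (λ p → proj₁ (isGenerator p)) (λ p → proj₂ (isGenerator p)) isK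
        open Cover Y P directed L.relabelled L.cocone L.isColimit
    in posetCategory closeds , smalls , cover , cover-isColimit

complete⇒terminal : {C : Category o ℓ} → Complete C → Terminal C
complete⇒terminal {ℓ = ℓ} {C} complete = record
  { one = proj₁ limit
  ; ! = mediate empty
  ; !-unique = λ f → unique empty f λ ()
  }
  where
  ∅ : Category ℓ ℓ
  ∅ = Full C {I = Lift ℓ ⊥} λ ()
  limit = complete ∅ (embed C λ ())
  open IsLimit (proj₂ (proj₂ limit))
  empty : ∀ {X} → Cone (embed C {I = Lift ℓ ⊥} λ ()) X
  empty = record { π = λ () ; commute = λ { {()} } }

theorem4p6 : (∀ a → ExcludedMiddle a) → (∀ a b → Extensionality a b) →
    ∀ {o ℓ : Level} (T : Set ℓ) (_·_ : T → T → T) (e : T)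
    (T-monoid : IsMonoid _≡_ _·_ e)
    (C : Category o ℓ) → IsLocallyPresentable C →
    (𝑀 : GradedMonad T-monoid C) →
    (∀ t → IsAccessibleFunctor (GradedMonad.M 𝑀 t)) →
    Complete (GCoAlg 𝑀) × Terminal (GCoAlg 𝑀)
theorem4p6 em _ T _·_ e T-monoid C ((κ , accessible) , cocomplete) 𝑀 M-accessible =
  complete , complete⇒terminal complete
  where
  complete : Complete (GCoAlg 𝑀)
  complete = cocomplete∧colimitGenerated⇒complete (GCoAlg-cocomplete 𝑀 cocomplete)
    (Generation.GCoAlg-colimitGenerated em cocomplete accessible 𝑀 M-accessible)
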